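{- Let $k\geq 2$. There is no $k$-geodetic digraph with minimum out-degree at least $2$ and order $M(2,k)+2$ (where $M(2,k)=1+2+\dots+2^k$) whose in-degree sequence is $(1,1,1,1,2,\dots,2,3,3,4)$, i.e. exactly four vertices have in-degree $1$, exactly two have in-degree $3$, exactly one has in-degree $4$, and all others have in-degree $2$.
   Context: A digraph is $k$-geodetic if for any two vertices $u,v$ there is at most one directed walk from $u$ to $v$ of length at most $k$. The in-degree sequence is the list of in-degrees of the vertices in non-decreasing order. -}

module Defs where

open import Data.Nat using (ℕ; zero; suc; _+_; _*_; _^_; _≤_; _≡ᵇ_)
open import Data.Bool using (Bool; true; T)
open import Data.Fin using (Fin)
open import Data.Vec using (allFin; countᵇ)
open import Data.Product using (Σ; _,_; _×_)
open import Relation.Binary.PropositionalEquality using (_≡_)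

-- A digraph on the vertex set Fin n, given by its arc relation.
-- (Loops and parallel arcs are irrelevant here: a k-geodetic digraph
-- with k ≥ 1 has neither, so a Boolean adjacency relation loses nothing.)
record Digraph (n : ℕ) : Set where
  field
    arc : Fin n → Fin n → Bool

open Digraph public

data Walk {n : ℕ} (G : Digraph n) : Fin n → Fin n → ℕ → Set where
  [] : ∀ {u} → Walk G u u 0
  _∷_ : ∀ {u w v ℓ} → T (arc G u w) → Walk G w v ℓ → Walk G u v (suc ℓ)

IsGeodetic : {n : ℕ} → ℕ → Digraph n → Set
IsGeodetic {n} k G =
  (u v : Fin n) (i j : ℕ) (p : Walk G u v i) (q : Walk G u v j) →
  i ≤ k → j ≤ k → _≡_ {A = Σ ℕ (Walk G u v)} (i , p) (j , q)

outDeg : {n : ℕ} → Digraph n → Fin n → ℕ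
outDeg {n} G u = countᵇ (λ w → arc G u w) (allFin n)

inDeg : {n : ℕ} → Digraph n → Fin n → ℕ
inDeg {n} G v = countᵇ (λ u → arc G u v) (allFin n)

MinOutDegAtLeast : {n : ℕ} → ℕ → Digraph n → Set
MinOutDegAtLeast {n} d G = (u : Fin n) → d ≤ outDeg G u

numInDeg : {n : ℕ} → Digraph n → ℕ → ℕ
numInDeg {n} G d = countᵇ (λ v → inDeg G v ≡ᵇ d) (allFin n)

HasInDegSeq1111-2-334 : {n : ℕ} → Digraph n → Set
HasInDegSeq1111-2-334 {n} G =
  (numInDeg G 1 ≡ 4) × (numInDeg G 3 ≡ 2) × (numInDeg G 4 ≡ 1) ×
  (numInDeg G 2 + 7 ≡ n)

M : ℕ → ℕ → ℕ
M d zero = 1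
M d (suc k) = M d k + d ^ suc k

module Submission where

-- Let A be the adjacency matrix, C = I + A + … + A^k, J the all-ones matrix and
-- s the indicator vector of the four vertices of in-degree 1.  Counting arcs
-- shows that G is 2-out-regular, and k-geodecity says that C ≤ J.  Since
-- A C = C A, the columns of A C at vertices of in-degree 1 are at most 1, while
-- all entries are at most 2; comparing row sums, A C = 2 J - 1 sᵀ.  Hence
-- A^(k+1) + C = I + 2 J - 1 sᵀ and A^(k+1+i) = A^i + 2^i J - 2^(i-1) 1 sᵀ for i ≥ 1,
-- so tr A^(k+1) = 2 M and tr A^(k+1+i) = 2^i M for 1 ≤ i ≤ k, where
-- M = M 2 k = 2^(k+1) - 1.  A closed walk of length N ≤ 2k + 1 has no repeated
-- vertex, so rotation gives N ∣ tr A^N.  These divisibilities are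
-- contradictory: 4 ∣ k + 1 would make M even, and otherwise 3 or 5 divides some
-- N in the range, but not M (for k = 2, 3 does not divide tr A^3 = 14).

open import Defs
open import Data.Bool using (Bool; true; false; T; if_then_else_)
open import Data.Empty using (⊥)
open import Data.Fin using (Fin; zero; suc)
import Data.Fin.Properties as Fin
open import Data.List using (List; []; _∷_; allFin)
open import Data.List.Membership.Propositional using (_∈_)
open import Data.List.Membership.Propositional.Properties using (∈-allFin)
open import Data.List.Relation.Unary.Any using (here; there)
open import Data.Nat
open import Data.Nat.Coprimality using (Coprime; coprime?; coprime-divisor)
open import Data.Nat.Divisibility
open import Data.Nat.DivMod using (m%n<n; m≡m%n+[m/n]*n)
open import Data.Nat.Properties
open import Data.Nat.Tactic.RingSolver using (solve-∀)
open import Data.Product using (Σ; ∃; _×_; _,_; proj₁; proj₂)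
import Data.Vec as Vec
open import Function using (_∘_; id)
open import Relation.Binary.PropositionalEquality
open import Relation.Nullary using (¬_; yes; no; does; contradiction)
open import Relation.Nullary.Decidable using (toWitness; toWitnessFalse)
open import Algebra.Properties.Semiring.Sum +-*-semiring
  using (sum; sum-syntax; sum-cong-≗; sum-replicate-zero; ∑-distrib-+; ∑-comm;
         *-distribˡ-sum; *-distribʳ-sum)

private variable n : ℕ

-- Finite sums of natural numbers

sum-mono : {f g : Fin n → ℕ} → (∀ i → f i ≤ g i) → sum f ≤ sum g
sum-mono {zero}  f≤g = z≤n
sum-mono {suc n} f≤g = +-mono-≤ (f≤g zero) (sum-mono (f≤g ∘ suc))

sum-const : ∀ n c → ∑[ i < n ] c ≡ n * c
sum-const zero    c = refl
sum-const (suc n) c = cong (c +_) (sum-const n c)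

sum-zero : {f : Fin n → ℕ} → (∀ i → f i ≡ 0) → sum f ≡ 0
sum-zero {n} f≡0 = trans (sum-cong-≗ f≡0) (sum-replicate-zero n)

term≤sum : (f : Fin n → ℕ) (i : Fin n) → f i ≤ sum f
term≤sum f zero    = m≤m+n (f zero) _
term≤sum f (suc i) = ≤-trans (term≤sum (f ∘ suc) i) (m≤n+m _ (f zero))

sum-positive⇒term-positive : (f : Fin n → ℕ) → 0 < sum f → ∃ λ i → 0 < f i
sum-positive⇒term-positive {suc n} f 0<∑ with f zero in eq
... | suc _ = zero , subst (0 <_) (sym eq) z<s
... | zero  with i , 0<fi ← sum-positive⇒term-positive (f ∘ suc) 0<∑ = suc i , 0<fi

sum-≤1 : (f : Fin n → ℕ) → (∀ i → f i ≤ 1) → (∀ i j → 0 < f i → 0 < f j → i ≡ j) →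
         sum f ≤ 1
sum-≤1 {zero}  f f≤1 unique = z≤n
sum-≤1 {suc n} f f≤1 unique with f zero in eq
... | zero  = sum-≤1 (f ∘ suc) (f≤1 ∘ suc) λ i j p q → Fin.suc-injective (unique (suc i) (suc j) p q)
... | suc m = subst (λ s → suc m + s ≤ 1) (sym tail≡0) (subst₂ _≤_ (trans eq (sym (+-identityʳ _))) refl (f≤1 zero))
  where
  tail≡0 : sum (f ∘ suc) ≡ 0
  tail≡0 = sum-zero λ i → n≤0⇒n≡0 (≮⇒≥ λ 0<fi →
    Fin.0≢1+n (unique zero (suc i) (subst (0 <_) (sym eq) z<s) 0<fi))

-- The gaps `g j ∸ f j` are nonnegative with total 0, so each one vanishes. Every double count below
-- becomes a pointwise equality through this lemma.
≤∧sum≡⇒≡ : {f g : Fin n → ℕ} → (∀ i → f i ≤ g i) → sum f ≡ sum g → ∀ i → f i ≡ g i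
≤∧sum≡⇒≡ {n} {f} {g} f≤g ∑≡ i = ≤-antisym (f≤g i) (m∸n≡0⇒m≤n gap≡0)
  where
  ∑gap≡0 : ∑[ j < n ] (g j ∸ f j) ≡ 0
  ∑gap≡0 = +-cancelˡ-≡ (sum f) _ _ (begin
    sum f + ∑[ j < n ] (g j ∸ f j)  ≡⟨ ∑-distrib-+ f _ ⟨
    ∑[ j < n ] (f j + (g j ∸ f j))  ≡⟨ sum-cong-≗ (λ j → m+[n∸m]≡n (f≤g j)) ⟩
    sum g                           ≡⟨ ∑≡ ⟨
    sum f                           ≡⟨ +-identityʳ _ ⟨
    sum f + 0                       ∎)
    where open ≡-Reasoning
  gap≡0 : g i ∸ f i ≡ 0
  gap≡0 = n≤0⇒n≡0 (≤-trans (term≤sum _ i) (≤-reflexive ∑gap≡0))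

bit : Bool → ℕ
bit b = if b then 1 else 0

countᵇ-tabulate : {A : Set} (p : A → Bool) (f : Fin n → A) →
                  Vec.countᵇ p (Vec.tabulate f) ≡ ∑[ i < n ] bit (p (f i))
countᵇ-tabulate {zero}  p f = refl
countᵇ-tabulate {suc n} p f with p (f zero)
... | true  = cong suc (countᵇ-tabulate p (f ∘ suc))
... | false = countᵇ-tabulate p (f ∘ suc)

-- Matrices over ℕ

Matrix : ℕ → Set
Matrix n = Fin n → Fin n → ℕ

infix  4 _≐_
infixl 7 _⊗_
infixl 6 _⊕_

_≐_ : Matrix n → Matrix n → Set
X ≐ Y = ∀ u v → X u v ≡ Y u v

_⊕_ _⊗_ : Matrix n → Matrix n → Matrix n
(X ⊕ Y) u v = X u v + Y u v
_⊗_ {n} X Y u v = ∑[ x < n ] (X u x * Y x v)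

I : Matrix n
I zero    zero    = 1
I zero    (suc v) = 0
I (suc u) zero    = 0
I (suc u) (suc v) = I u v

I-diag : (u : Fin n) → I u u ≡ 1
I-diag zero    = refl
I-diag (suc u) = I-diag u

I-off-diag : {u v : Fin n} → u ≢ v → I u v ≡ 0
I-off-diag {u = zero}  {zero}  u≢v = contradiction refl u≢v
I-off-diag {u = zero}  {suc v} u≢v = refl
I-off-diag {u = suc u} {zero}  u≢v = refl
I-off-diag {u = suc u} {suc v} u≢v = I-off-diag (u≢v ∘ cong suc)

⊗-cong : {X X′ Y Y′ : Matrix n} → X ≐ X′ → Y ≐ Y′ → X ⊗ Y ≐ X′ ⊗ Y′
⊗-cong p q u v = sum-cong-≗ λ x → cong₂ _*_ (p u x) (q x v)

⊗-congˡ : {X Y Y′ : Matrix n} → Y ≐ Y′ → X ⊗ Y ≐ X ⊗ Y′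
⊗-congˡ {X = X} = ⊗-cong {X = X} λ _ _ → refl

⊗-congʳ : {X X′ Y : Matrix n} → X ≐ X′ → X ⊗ Y ≐ X′ ⊗ Y
⊗-congʳ {Y = Y} p = ⊗-cong {Y = Y} p λ _ _ → refl

⊗-mono : {X X′ Y Y′ : Matrix n} → (∀ u v → X u v ≤ X′ u v) → (∀ u v → Y u v ≤ Y′ u v) →
         ∀ u v → (X ⊗ Y) u v ≤ (X′ ⊗ Y′) u v
⊗-mono p q u v = sum-mono λ x → *-mono-≤ (p u x) (q x v)

sum-I : (f : Fin n → ℕ) (u : Fin n) → ∑[ x < n ] (I u x * f x) ≡ f u
sum-I {suc n} f zero    = trans (cong₂ _+_ (+-identityʳ (f zero)) (sum-replicate-zero n)) (+-identityʳ (f zero))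
sum-I {suc n} f (suc u) = sum-I (f ∘ suc) u

I-sym : (u v : Fin n) → I u v ≡ I v u
I-sym zero    zero    = refl
I-sym zero    (suc v) = refl
I-sym (suc u) zero    = refl
I-sym (suc u) (suc v) = I-sym u v

⊗-identityˡ : (X : Matrix n) → I ⊗ X ≐ X
⊗-identityˡ X u v = sum-I (λ x → X x v) u

⊗-identityʳ : (X : Matrix n) → X ⊗ I ≐ X
⊗-identityʳ X u v = trans
  (sum-cong-≗ λ x → trans (*-comm (X u x) (I x v)) (cong (_* X u x) (I-sym x v)))
  (sum-I (X u) v)

⊗-assoc : (X Y Z : Matrix n) → (X ⊗ Y) ⊗ Z ≐ X ⊗ (Y ⊗ Z)
⊗-assoc {n} X Y Z u v = begin
  ∑[ y < n ] (∑[ x < n ] (X u x * Y x y) * Z y v)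
    ≡⟨ sum-cong-≗ (λ y → *-distribʳ-sum (Z y v) (λ x → X u x * Y x y)) ⟩
  ∑[ y < n ] ∑[ x < n ] (X u x * Y x y * Z y v)
    ≡⟨ ∑-comm (λ y x → X u x * Y x y * Z y v) ⟩
  ∑[ x < n ] ∑[ y < n ] (X u x * Y x y * Z y v)
    ≡⟨ sum-cong-≗ (λ x → sum-cong-≗ λ y → *-assoc (X u x) (Y x y) (Z y v)) ⟩
  ∑[ x < n ] ∑[ y < n ] (X u x * (Y x y * Z y v))
    ≡⟨ sum-cong-≗ (λ x → sym (*-distribˡ-sum (X u x) (λ y → Y x y * Z y v))) ⟩
  ∑[ x < n ] (X u x * ∑[ y < n ] (Y x y * Z y v)) ∎
  where open ≡-Reasoning

⊗-distribˡ-⊕ : (X Y Z : Matrix n) → X ⊗ (Y ⊕ Z) ≐ (X ⊗ Y) ⊕ (X ⊗ Z)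
⊗-distribˡ-⊕ X Y Z u v = trans
  (sum-cong-≗ λ x → *-distribˡ-+ (X u x) (Y x v) (Z x v))
  (∑-distrib-+ (λ x → X u x * Y x v) _)

⊗-distribʳ-⊕ : (X Y Z : Matrix n) → (Y ⊕ Z) ⊗ X ≐ (Y ⊗ X) ⊕ (Z ⊗ X)
⊗-distribʳ-⊕ X Y Z u v = trans
  (sum-cong-≗ λ x → *-distribʳ-+ (X x v) (Y u x) (Z u x))
  (∑-distrib-+ (λ x → Y u x * X x v) _)

infixr 8 _^^_

_^^_ : Matrix n → ℕ → Matrix n
X ^^ zero  = I
X ^^ suc m = X ⊗ X ^^ m

^^-+ : (X : Matrix n) (i j : ℕ) → X ^^ i ⊗ X ^^ j ≐ X ^^ (i + j)
^^-+ X zero    j u v = ⊗-identityˡ (X ^^ j) u v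
^^-+ X (suc i) j u v = trans (⊗-assoc X (X ^^ i) (X ^^ j) u v) (⊗-congˡ {X = X} (^^-+ X i j) u v)

^^-sucʳ : (X : Matrix n) (i : ℕ) → X ^^ i ⊗ X ≐ X ^^ suc i
^^-sucʳ X i u v = begin
  (X ^^ i ⊗ X) u v      ≡⟨ ⊗-congˡ {X = X ^^ i} (⊗-identityʳ X) u v ⟨
  (X ^^ i ⊗ X ^^ 1) u v ≡⟨ ^^-+ X i 1 u v ⟩
  (X ^^ (i + 1)) u v    ≡⟨ cong (λ m → (X ^^ m) u v) (+-comm i 1) ⟩
  (X ^^ suc i) u v      ∎
  where open ≡-Reasoning

^^-mono : {X Y : Matrix n} → (∀ u v → X u v ≤ Y u v) → ∀ m u v → (X ^^ m) u v ≤ (Y ^^ m) u v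
^^-mono p zero    u v = ≤-refl
^^-mono p (suc m) u v = ⊗-mono p (^^-mono p m) u v

tr : Matrix n → ℕ
tr {n} X = ∑[ u < n ] X u u

-- Closed walks and rotation

-- Deletes the arcs out of `v`. Closed walks of positive length in the resulting digraph are those
-- that avoid `v`, which permits induction over the vertices.
clearRow : Fin n → Matrix n → Matrix n
clearRow v X u w = if does (u Fin.≟ v) then 0 else X u w

module _ (v : Fin n) (A : Matrix n) where

  private B = clearRow v A

  clearRow-≤ : ∀ u w → B u w ≤ A u w
  clearRow-≤ u w with does (u Fin.≟ v)
  ... | true  = z≤n
  ... | false = ≤-refl

  clearRow-split : ∀ u w → A u w ≡ B u w + I u v * A v w
  clearRow-split u w with u Fin.≟ v
  ... | yes refl = sym (trans (cong (_* A u w) (I-diag u)) (+-identityʳ (A u w)))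
  ... | no u≢v   = sym (trans (cong (λ t → A u w + t * A v w) (I-off-diag u≢v)) (+-identityʳ (A u w)))

  -- Sorts walks by where the distinguished `A` step starts. If it starts at `v`, the walk factors
  -- there into an `X` part ending at `v` and an `A ⊗ Y` part leaving `v`.
  ⊗-clearRow-split : (X Y : Matrix n) → ∀ u w →
    (X ⊗ (A ⊗ Y)) u w ≡ (X ⊗ (B ⊗ Y)) u w + X u v * (A ⊗ Y) v w
  ⊗-clearRow-split X Y u w = begin
    (X ⊗ (A ⊗ Y)) u w                                   ≡⟨ ⊗-congˡ {X = X} A⊗Y≐ u w ⟩
    (X ⊗ (B ⊗ Y ⊕ R)) u w                               ≡⟨ ⊗-distribˡ-⊕ X (B ⊗ Y) R u w ⟩
    (X ⊗ (B ⊗ Y)) u w + (X ⊗ R) u w                     ≡⟨ cong ((X ⊗ (B ⊗ Y)) u w +_) X⊗R≡ ⟩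
    (X ⊗ (B ⊗ Y)) u w + X u v * (A ⊗ Y) v w             ∎
    where
    open ≡-Reasoning
    R : Matrix n
    R x z = I x v * (A ⊗ Y) v z
    A⊗Y≐ : A ⊗ Y ≐ B ⊗ Y ⊕ R
    A⊗Y≐ x z = begin
      (A ⊗ Y) x z
        ≡⟨ ⊗-congʳ {Y = Y} clearRow-split x z ⟩
      ((B ⊕ λ x z → I x v * A v z) ⊗ Y) x z
        ≡⟨ ⊗-distribʳ-⊕ Y B (λ x z → I x v * A v z) x z ⟩
      (B ⊗ Y) x z + ∑[ y < n ] (I x v * A v y * Y y z)
        ≡⟨ cong ((B ⊗ Y) x z +_) (sum-cong-≗ λ y → *-assoc (I x v) (A v y) (Y y z)) ⟩
      (B ⊗ Y) x z + ∑[ y < n ] (I x v * (A v y * Y y z))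
        ≡⟨ cong ((B ⊗ Y) x z +_) (*-distribˡ-sum (I x v) (λ y → A v y * Y y z)) ⟨
      (B ⊗ Y ⊕ R) x z ∎
    X⊗R≡ : (X ⊗ R) u w ≡ X u v * (A ⊗ Y) v w
    X⊗R≡ = begin
      ∑[ x < n ] (X u x * (I x v * (A ⊗ Y) v w))
        ≡⟨ sum-cong-≗ (λ x → *-assoc (X u x) (I x v) ((A ⊗ Y) v w)) ⟨
      ∑[ x < n ] (X u x * I x v * (A ⊗ Y) v w)
        ≡⟨ *-distribʳ-sum ((A ⊗ Y) v w) (λ x → X u x * I x v) ⟨
      (X ⊗ I) u v * (A ⊗ Y) v w
        ≡⟨ cong (_* (A ⊗ Y) v w) (⊗-identityʳ X u v) ⟩
      X u v * (A ⊗ Y) v w ∎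

-- For an adjacency matrix: no closed walk of length N revisits its starting
-- point before the end.
NoEarlyReturn : ℕ → Matrix n → Set
NoEarlyReturn N A = ∀ u a b → suc a + suc b ≡ N → (A ^^ suc a) u u * (A ^^ suc b) u u ≡ 0

module _ (v : Fin n) (A : Matrix n) where

  private B = clearRow v A

  -- A closed walk at `v` that does not return early never leaves `v` again after its first step, so
  -- any later block of `A` factors may be replaced by `B`. The first factors remain `A ^^ suc m`
  -- because step one does leave `v`. The induction turns the `B` factors back into `A`, one at a
  -- time from the left.
  return-avoiding : ∀ N → NoEarlyReturn N A → ∀ m j i → suc m + j + i ≡ N →
    (A ^^ suc m ⊗ (B ^^ j ⊗ A ^^ i)) v v ≡ (A ^^ N) v v
  return-avoiding N simple m zero i eq = begin
    (A ^^ suc m ⊗ (I ⊗ A ^^ i)) v v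
      ≡⟨ ⊗-congˡ {X = A ^^ suc m} (⊗-identityˡ (A ^^ i)) v v ⟩
    (A ^^ suc m ⊗ A ^^ i) v v   ≡⟨ ^^-+ A (suc m) i v v ⟩
    (A ^^ (suc m + i)) v v
      ≡⟨ cong (λ l → (A ^^ l) v v) (trans (cong (_+ i) (sym (+-identityʳ (suc m)))) eq) ⟩
    (A ^^ N) v v                ∎
    where open ≡-Reasoning
  return-avoiding N simple m (suc j) i eq = begin
    (A ^^ suc m ⊗ (B ⊗ B ^^ j ⊗ A ^^ i)) v v
      ≡⟨ ⊗-congˡ {X = A ^^ suc m} (⊗-assoc B (B ^^ j) (A ^^ i)) v v ⟩
    (A ^^ suc m ⊗ (B ⊗ Y)) v v
      ≡⟨ +-identityʳ _ ⟨
    (A ^^ suc m ⊗ (B ⊗ Y)) v v + 0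
      ≡⟨ cong ((A ^^ suc m ⊗ (B ⊗ Y)) v v +_) early≡0 ⟨
    (A ^^ suc m ⊗ (B ⊗ Y)) v v + (A ^^ suc m) v v * (A ⊗ Y) v v
      ≡⟨ ⊗-clearRow-split v A (A ^^ suc m) Y v v ⟨
    (A ^^ suc m ⊗ (A ⊗ Y)) v v
      ≡⟨ ⊗-assoc (A ^^ suc m) A Y v v ⟨
    (A ^^ suc m ⊗ A ⊗ Y) v v
      ≡⟨ ⊗-congʳ {Y = Y} (^^-sucʳ A (suc m)) v v ⟩
    (A ^^ suc (suc m) ⊗ Y) v v
      ≡⟨ return-avoiding N simple (suc m) j i (trans (cong (λ l → suc l + i) (sym (+-suc m j))) eq) ⟩
    (A ^^ N) v v ∎
    where
    open ≡-Reasoning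
    Y = B ^^ j ⊗ A ^^ i
    A⊗Y≤ : (A ⊗ Y) v v ≤ (A ^^ suc (j + i)) v v
    A⊗Y≤ = ⊗-mono {X = A} (λ _ _ → ≤-refl) (λ x z → ≤-trans
      (⊗-mono {Y = A ^^ i} (^^-mono (clearRow-≤ v A) j) (λ _ _ → ≤-refl) x z)
      (≤-reflexive (^^-+ A j i x z))) v v
    -- The correction term counts pairs of nonempty closed walks at `v` of total length `N`;
    -- bounding `B` by `A` in the second factor puts it under `NoEarlyReturn`.
    early≡0 : (A ^^ suc m) v v * (A ⊗ Y) v v ≡ 0
    early≡0 = n≤0⇒n≡0 (≤-trans (*-monoʳ-≤ ((A ^^ suc m) v v) A⊗Y≤)
      (≤-reflexive (simple v m (j + i) (trans
        (cong suc (sym (+-assoc m (suc j) i))) eq))))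

  -- Trading one `A` for a `B` discards the closed walks that leave `v` at that fixed time. Rotated
  -- to start at `v`, these are all the closed walks counted by `(A ^^ N) v v`, so each of the `i`
  -- trades costs the same amount.
  tr-clearRow : ∀ N → NoEarlyReturn N A → ∀ i j → i + j ≡ N →
    tr (A ^^ i ⊗ B ^^ j) ≡ tr (B ^^ N) + i * (A ^^ N) v v
  tr-clearRow N simple zero j refl = trans
    (sum-cong-≗ λ u → ⊗-identityˡ (B ^^ j) u u) (sym (+-identityʳ _))
  tr-clearRow N simple (suc i) j eq = begin
    tr (A ^^ suc i ⊗ B ^^ j)
      ≡⟨ sum-cong-≗ (λ u → trans (⊗-congʳ {Y = B ^^ j} (λ x z → sym (^^-sucʳ A i x z)) u u)
           (⊗-assoc (A ^^ i) A (B ^^ j) u u)) ⟩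
    tr (A ^^ i ⊗ (A ⊗ B ^^ j))
      ≡⟨ sum-cong-≗ (λ u → ⊗-clearRow-split v A (A ^^ i) (B ^^ j) u u) ⟩
    ∑[ u < n ] ((A ^^ i ⊗ B ^^ suc j) u u + (A ^^ i) u v * (A ⊗ B ^^ j) v u)
      ≡⟨ ∑-distrib-+ (λ u → (A ^^ i ⊗ B ^^ suc j) u u) _ ⟩
    tr (A ^^ i ⊗ B ^^ suc j) + ∑[ u < n ] ((A ^^ i) u v * (A ⊗ B ^^ j) v u)
      ≡⟨ cong₂ _+_ (tr-clearRow N simple i (suc j) (trans (+-suc i j) eq)) returns ⟩
    tr (B ^^ N) + i * c + c   ≡⟨ +-assoc (tr (B ^^ N)) (i * c) c ⟩
    tr (B ^^ N) + (i * c + c) ≡⟨ cong (tr (B ^^ N) +_) (+-comm (i * c) c) ⟩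
    tr (B ^^ N) + suc i * c   ∎
    where
    open ≡-Reasoning
    c = (A ^^ N) v v
    -- Commuting the two factors under the sum is the rotation: the walk now begins with its step
    -- out of `v`.
    returns : ∑[ u < n ] ((A ^^ i) u v * (A ⊗ B ^^ j) v u) ≡ c
    returns = begin
      ∑[ u < n ] ((A ^^ i) u v * (A ⊗ B ^^ j) v u)
        ≡⟨ sum-cong-≗ (λ u → *-comm ((A ^^ i) u v) ((A ⊗ B ^^ j) v u)) ⟩
      (A ⊗ B ^^ j ⊗ A ^^ i) v v
        ≡⟨ ⊗-assoc A (B ^^ j) (A ^^ i) v v ⟩
      (A ⊗ (B ^^ j ⊗ A ^^ i)) v v
        ≡⟨ ⊗-congʳ {Y = B ^^ j ⊗ A ^^ i} (⊗-identityʳ A) v v ⟨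
      (A ^^ 1 ⊗ (B ^^ j ⊗ A ^^ i)) v v
        ≡⟨ return-avoiding N simple 0 j i (trans (cong suc (+-comm j i)) eq) ⟩
      c ∎

-- Each closed walk through v is counted once for each of its N rotations, so
-- deleting the arcs out of v lowers the trace by N · (A ^^ N) v v.
∣tr-^^-on : ∀ N .{{_ : NonZero N}} (vs : List (Fin n)) (A : Matrix n) →
  (∀ u w → A u w ≢ 0 → u ∈ vs) → NoEarlyReturn N A → N ∣ tr (A ^^ N)
∣tr-^^-on (suc N) [] A supp simple = subst (suc N ∣_) (sym (sum-zero λ u → sum-zero λ x → cong (_* (A ^^ N) x u) (A≡0 u x))) (suc N ∣0)
  where
  A≡0 : ∀ u w → A u w ≡ 0
  A≡0 u w with A u w in eq
  ... | zero  = refl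
  ... | suc _ with () ← supp u w (λ e → contradiction (trans (sym eq) e) λ ())
∣tr-^^-on N (v ∷ vs) A supp simple = subst (N ∣_) (sym split)
  (∣m∣n⇒∣m+n (∣tr-^^-on N vs B supp′ simple′) (m∣m*n _))
  where
  B = clearRow v A
  supp′ : ∀ u w → B u w ≢ 0 → u ∈ vs
  supp′ u w Buw≢0 with u Fin.≟ v
  ... | yes _   = contradiction refl Buw≢0
  ... | no u≢v with supp u w Buw≢0
  ...   | here u≡v  = contradiction u≡v u≢v
  ...   | there u∈  = u∈
  simple′ : NoEarlyReturn N B
  simple′ u a b eq = n≤0⇒n≡0 (≤-trans
    (*-mono-≤ (^^-mono (clearRow-≤ v A) (suc a) u u) (^^-mono (clearRow-≤ v A) (suc b) u u))
    (≤-reflexive (simple u a b eq)))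
  split : tr (A ^^ N) ≡ tr (B ^^ N) + N * (A ^^ N) v v
  split = trans (sum-cong-≗ λ u → sym (⊗-identityʳ (A ^^ N) u u))
    (tr-clearRow v A N simple N 0 (+-identityʳ N))

∣tr-^^ : ∀ N .{{_ : NonZero N}} (A : Matrix n) → NoEarlyReturn N A → N ∣ tr (A ^^ N)
∣tr-^^ {n} N A = ∣tr-^^-on N (allFin n) A λ u _ _ → ∈-allFin u

-- Geodetic digraphs

-- The sum I + A + ... + A^m in Horner form, so that unfolding it peels off the first arc of a walk.
geo : Matrix n → ℕ → Matrix n
geo A zero    = I
geo A (suc m) = I ⊕ A ⊗ geo A m

geo-suc : (A : Matrix n) (m : ℕ) → geo A (suc m) ≐ geo A m ⊕ A ^^ suc m
geo-suc A zero    u v = refl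
geo-suc A (suc m) u v = begin
  I u v + (A ⊗ geo A (suc m)) u v
    ≡⟨ cong (I u v +_) (⊗-congˡ {X = A} (geo-suc A m) u v) ⟩
  I u v + (A ⊗ (geo A m ⊕ A ^^ suc m)) u v
    ≡⟨ cong (I u v +_) (⊗-distribˡ-⊕ A (geo A m) (A ^^ suc m) u v) ⟩
  I u v + ((A ⊗ geo A m) u v + (A ^^ suc (suc m)) u v)
    ≡⟨ +-assoc (I u v) _ _ ⟨
  geo A (suc m) u v + (A ^^ suc (suc m)) u v ∎
  where open ≡-Reasoning

-- Lets the last arc of a walk be singled out instead of the first, which brings in the in-degree of
-- the endpoint.
geo-comm : (A : Matrix n) (m : ℕ) → A ⊗ geo A m ≐ geo A m ⊗ A
geo-comm A zero    u v = trans (⊗-identityʳ A u v) (sym (⊗-identityˡ A u v))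
geo-comm A (suc m) u v = begin
  (A ⊗ (I ⊕ A ⊗ geo A m)) u v
    ≡⟨ ⊗-distribˡ-⊕ A I (A ⊗ geo A m) u v ⟩
  (A ⊗ I) u v + (A ⊗ (A ⊗ geo A m)) u v
    ≡⟨ cong₂ _+_ (geo-comm A 0 u v) (⊗-congˡ {X = A} (geo-comm A m) u v) ⟩
  (I ⊗ A) u v + (A ⊗ (geo A m ⊗ A)) u v
    ≡⟨ cong ((I ⊗ A) u v +_) (⊗-assoc A (geo A m) A u v) ⟨
  (I ⊗ A) u v + (A ⊗ geo A m ⊗ A) u v
    ≡⟨ ⊗-distribʳ-⊕ A I (A ⊗ geo A m) u v ⟨
  (geo A (suc m) ⊗ A) u v ∎
  where open ≡-Reasoning

I≤geo : (A : Matrix n) (m : ℕ) (u v : Fin n) → I u v ≤ geo A m u v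
I≤geo A zero    u v = ≤-refl
I≤geo A (suc m) u v = m≤m+n (I u v) _

^^≤geo : (A : Matrix n) {i m : ℕ} → i ≤ m → ∀ u v → (A ^^ i) u v ≤ geo A m u v
^^≤geo A {m = m} z≤n u v = I≤geo A m u v
^^≤geo A (s≤s i≤m) u v = ≤-trans (⊗-mono {X = A} (λ _ _ → ≤-refl) (^^≤geo A i≤m) u v) (m≤n+m _ (I u v))

adjacency : Digraph n → Matrix n
adjacency G u v = bit (arc G u v)

0<bit⇒T : ∀ b → 0 < bit b → T b
0<bit⇒T true _ = _

bit≤1 : ∀ b → bit b ≤ 1
bit≤1 true  = ≤-refl
bit≤1 false = z≤n

0<*⇒0< : ∀ a b → 0 < a * b → 0 < a × 0 < b
0<*⇒0< (suc a) (suc b) _ = z<s , z<s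
0<*⇒0< (suc a) zero    p = contradiction (subst (0 <_) (*-zeroʳ a) p) λ ()

module _ (G : Digraph n) where

  private A = adjacency G

  geo⇒walk : ∀ m u v → 0 < geo A m u v → ∃ λ ℓ → ℓ ≤ m × Walk G u v ℓ
  ⊗geo⇒walk : ∀ m u v x → 0 < A u x * geo A m x v → T (arc G u x) × ∃ λ ℓ → ℓ ≤ m × Walk G x v ℓ

  geo⇒walk m u v 0<geo with u Fin.≟ v
  geo⇒walk m u .u 0<geo | yes refl = 0 , z≤n , []
  geo⇒walk zero u v 0<geo | no u≢v = contradiction (subst (0 <_) (I-off-diag u≢v) 0<geo) λ ()
  geo⇒walk (suc m) u v 0<geo | no u≢v
    with x , 0<term ← sum-positive⇒term-positive (λ x → A u x * geo A m x v)
           (subst (λ t → 0 < t + (A ⊗ geo A m) u v) (I-off-diag u≢v) 0<geo)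
    with a , ℓ , ℓ≤m , w ← ⊗geo⇒walk m u v x 0<term = suc ℓ , s≤s ℓ≤m , a ∷ w

  ⊗geo⇒walk m u v x 0<term with 0<a , 0<geo ← 0<*⇒0< (A u x) (geo A m x v) 0<term =
    0<bit⇒T (arc G u x) 0<a , geo⇒walk m x v 0<geo

  -- Distinguishes walks by their first arc. The start vertex is a default value for the empty walk.
  secondVertex : ∀ {u v} → Σ ℕ (Walk G u v) → Fin n
  secondVertex {u} (_ , [])            = u
  secondVertex     (_ , _∷_ {w = w} _ _) = w

  -- Induction on `m` along the first arc. On the diagonal the empty walk is already counted, and a
  -- return would be a second short walk. Off the diagonal each summand is at most 1, and two
  -- positive summands would give short walks with different second vertices.
  geo≤1 : ∀ m → IsGeodetic m G → ∀ u v → geo A m u v ≤ 1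
  geo≤1 m geodetic u v with u Fin.≟ v
  geo≤1 zero geodetic u v | yes refl = ≤-reflexive (I-diag u)
  geo≤1 zero geodetic u v | no u≢v   = ≤-trans (≤-reflexive (I-off-diag u≢v)) z≤n
  geo≤1 (suc m) geodetic u v | yes refl = ≤-reflexive (cong₂ _+_ (I-diag u) (sum-zero noReturn))
    where
    noReturn : ∀ x → A u x * geo A m x u ≡ 0
    noReturn x with A u x * geo A m x u in eq
    ... | zero  = refl
    ... | suc _ with a , ℓ , ℓ≤m , w ← ⊗geo⇒walk m u u x (subst (0 <_) (sym eq) z<s)
                with () ← geodetic u u (suc ℓ) 0 (a ∷ w) [] (s≤s ℓ≤m) z≤n
  geo≤1 (suc m) geodetic u v | no u≢v = subst (λ t → t + (A ⊗ geo A m) u v ≤ 1) (sym (I-off-diag u≢v))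
    (sum-≤1 (λ x → A u x * geo A m x v)
      (λ x → *-mono-≤ (bit≤1 (arc G u x)) (geo≤1 m geodetic′ x v)) unique)
    where
    geodetic′ : IsGeodetic m G
    geodetic′ x y i j p q i≤m j≤m = geodetic x y i j p q (m≤n⇒m≤1+n i≤m) (m≤n⇒m≤1+n j≤m)
    unique : ∀ x y → 0 < A u x * geo A m x v → 0 < A u y * geo A m y v → x ≡ y
    unique x y 0<x 0<y
      with a , ℓ , ℓ≤m , w ← ⊗geo⇒walk m u v x 0<x
      with a′ , ℓ′ , ℓ′≤m , w′ ← ⊗geo⇒walk m u v y 0<y =
      cong secondVertex (geodetic u v (suc ℓ) (suc ℓ′) (a ∷ w) (a′ ∷ w′) (s≤s ℓ≤m) (s≤s ℓ′≤m))

  inDeg≡sum : ∀ v → inDeg G v ≡ ∑[ u < n ] A u v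
  inDeg≡sum v = countᵇ-tabulate (λ u → arc G u v) id

  outDeg≡sum : ∀ u → outDeg G u ≡ ∑[ v < n ] A u v
  outDeg≡sum u = countᵇ-tabulate (arc G u) id

  numInDeg≡sum : ∀ d → numInDeg G d ≡ ∑[ v < n ] bit (inDeg G v ≡ᵇ d)
  numInDeg≡sum d = countᵇ-tabulate (λ v → inDeg G v ≡ᵇ d) id

  module _ {k : ℕ} (geodetic : IsGeodetic k G) where

    -- The diagonal of `geo A k` is at most 1, and the summand `I` already uses this up.
    closed-walks-of-length≤k : ∀ {i} → 0 < i → i ≤ k → ∀ u → (A ^^ i) u u ≡ 0
    closed-walks-of-length≤k {suc i} _ (s≤s {n = k′} i≤k′) u = n≤0⇒n≡0 (≤-trans
      (⊗-mono {X = A} (λ _ _ → ≤-refl) (^^≤geo A i≤k′) u u)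
      (+-cancelˡ-≤ 1 _ _ (subst (λ t → t + (A ⊗ geo A k′) u u ≤ 1) (I-diag u) (geo≤1 (suc k′) geodetic u u))))

    -- If two lengths add up to at most 2k + 1, one of them is at most k.
    geodetic⇒NoEarlyReturn : ∀ {N} → N ≤ suc (k + k) → NoEarlyReturn N A
    geodetic⇒NoEarlyReturn N≤ u a b refl with suc a ≤? k | suc b ≤? k
    ... | yes a<k | _       = cong (_* (A ^^ suc b) u u) (closed-walks-of-length≤k z<s a<k u)
    ... | no _    | yes b<k = trans (cong ((A ^^ suc a) u u *_) (closed-walks-of-length≤k z<s b<k u)) (*-zeroʳ ((A ^^ suc a) u u))
    ... | no a≮k  | no b≮k  = contradiction N≤ (<⇒≱ (≤-trans
      (≤-reflexive (cong suc (sym (+-suc k k)))) (+-mono-≤ (≰⇒> a≮k) (≰⇒> b≮k))))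

-- Values of `M` and degree counts

M≡ : ∀ m → suc (M 2 m) ≡ 2 ^ suc m
M≡ zero    = refl
M≡ (suc m) = trans (cong (_+ 2 ^ suc m) (M≡ m)) (cong (2 ^ suc m +_) (sym (+-identityʳ _)))

M-suc : ∀ m → M 2 (suc m) ≡ 1 + 2 * M 2 m
M-suc m = suc-injective (trans (M≡ (suc m)) (trans (cong (2 *_) (sym (M≡ m))) (*-suc 2 (M 2 m))))

sum-⊗ : (X Y : Matrix n) {c : ℕ} → (∀ x → ∑[ v < n ] Y x v ≡ c) →
        ∀ u → ∑[ v < n ] (X ⊗ Y) u v ≡ ∑[ x < n ] X u x * c
sum-⊗ {n} X Y {c} rows u = begin
  ∑[ v < n ] ∑[ x < n ] (X u x * Y x v) ≡⟨ ∑-comm (λ v x → X u x * Y x v) ⟩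
  ∑[ x < n ] ∑[ v < n ] (X u x * Y x v) ≡⟨ sum-cong-≗ (λ x → trans (sym (*-distribˡ-sum (X u x) (Y x))) (cong (X u x *_) (rows x))) ⟩
  ∑[ x < n ] (X u x * c)                ≡⟨ *-distribʳ-sum c (X u) ⟨
  ∑[ x < n ] X u x * c                  ∎
  where open ≡-Reasoning

-- A vertex of in-degree outside {1,2,3,4} would push n₁ + n₂ + n₃ + n₄ below n.
inDeg-sum : (G : Digraph n) → HasInDegSeq1111-2-334 G → ∑[ v < n ] inDeg G v ≡ n * 2
inDeg-sum {n} G (n₁ , n₃ , n₄ , n₂) = begin
  ∑[ v < n ] inDeg G v
    ≡⟨ sum-cong-≗ (λ v → sym (weighted (inDeg G v) (present v))) ⟩
  ∑[ v < n ] (χ 1 v + 2 * χ 2 v + 3 * χ 3 v + 4 * χ 4 v)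
    ≡⟨ sum₄ (χ 1) (λ v → 2 * χ 2 v) (λ v → 3 * χ 3 v) (λ v → 4 * χ 4 v) ⟩
  sum (χ 1) + ∑[ v < n ] (2 * χ 2 v) + ∑[ v < n ] (3 * χ 3 v) + ∑[ v < n ] (4 * χ 4 v)
    ≡⟨ cong₂ _+_ (cong₂ _+_ (cong₂ _+_ (num 1 n₁) (scaled 2 refl)) (scaled 3 n₃)) (scaled 4 n₄) ⟩
  4 + 2 * numInDeg G 2 + 6 + 4
    ≡⟨ regroup (numInDeg G 2) ⟩
  (numInDeg G 2 + 7) * 2
    ≡⟨ cong (_* 2) n₂ ⟩
  n * 2 ∎
  where
  open ≡-Reasoning
  regroup : ∀ x → 4 + 2 * x + 6 + 4 ≡ (x + 7) * 2
  regroup = solve-∀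
  χ : ℕ → Fin n → ℕ
  χ d v = bit (inDeg G v ≡ᵇ d)
  num : ∀ d {c} → numInDeg G d ≡ c → sum (χ d) ≡ c
  num d eq = trans (sym (numInDeg≡sum G d)) eq
  scaled : ∀ d {c} → numInDeg G d ≡ c → ∑[ v < n ] (d * χ d v) ≡ d * c
  scaled d eq = trans (sym (*-distribˡ-sum d (χ d))) (cong (d *_) (num d eq))
  sum₄ : (f g h l : Fin n → ℕ) →
         ∑[ v < n ] (f v + g v + h v + l v) ≡ sum f + sum g + sum h + sum l
  sum₄ f g h l = trans (∑-distrib-+ (λ v → f v + g v + h v) l) (cong (_+ sum l)
    (trans (∑-distrib-+ (λ v → f v + g v) h) (cong (_+ sum h) (∑-distrib-+ f g))))
  total : ℕ → ℕ
  total d = bit (d ≡ᵇ 1) + bit (d ≡ᵇ 2) + bit (d ≡ᵇ 3) + bit (d ≡ᵇ 4)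
  total≤1 : ∀ d → total d ≤ 1
  total≤1 0 = z≤n
  total≤1 1 = ≤-refl
  total≤1 2 = ≤-refl
  total≤1 3 = ≤-refl
  total≤1 4 = ≤-refl
  total≤1 (suc (suc (suc (suc (suc _))))) = z≤n
  present : ∀ v → total (inDeg G v) ≡ 1
  present = ≤∧sum≡⇒≡ (λ v → total≤1 (inDeg G v)) (begin
    ∑[ v < n ] total (inDeg G v)
      ≡⟨ sum₄ (χ 1) (χ 2) (χ 3) (χ 4) ⟩
    sum (χ 1) + sum (χ 2) + sum (χ 3) + sum (χ 4)
      ≡⟨ cong₂ _+_ (cong₂ _+_ (cong₂ _+_ (num 1 n₁) (num 2 refl)) (num 3 n₃)) (num 4 n₄) ⟩
    4 + numInDeg G 2 + 2 + 1
      ≡⟨ regroup′ (numInDeg G 2) ⟩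
    numInDeg G 2 + 7
      ≡⟨ trans n₂ (sym (*-identityʳ n)) ⟩
    n * 1
      ≡⟨ sum-const n 1 ⟨
    ∑[ v < n ] 1 ∎)
    where
    regroup′ : ∀ x → 4 + x + 2 + 1 ≡ x + 7
    regroup′ = solve-∀
  weighted : ∀ d → total d ≡ 1 →
    bit (d ≡ᵇ 1) + 2 * bit (d ≡ᵇ 2) + 3 * bit (d ≡ᵇ 3) + 4 * bit (d ≡ᵇ 4) ≡ d
  weighted 1 _ = refl
  weighted 2 _ = refl
  weighted 3 _ = refl
  weighted 4 _ = refl
  weighted 0 ()
  weighted (suc (suc (suc (suc (suc _))))) ()

-- The out-degrees are at least 2 and, like the in-degrees, sum to 2n.
out-regular : (G : Digraph n) → MinOutDegAtLeast 2 G → HasInDegSeq1111-2-334 G →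
              ∀ u → ∑[ v < n ] adjacency G u v ≡ 2
out-regular {n} G out≥2 inDegs u = sym (≤∧sum≡⇒≡
  (λ u → subst (2 ≤_) (outDeg≡sum G u) (out≥2 u)) (begin
    ∑[ u < n ] 2                          ≡⟨ sum-const n 2 ⟩
    n * 2                                 ≡⟨ inDeg-sum G inDegs ⟨
    ∑[ v < n ] inDeg G v                  ≡⟨ sum-cong-≗ (inDeg≡sum G) ⟩
    ∑[ v < n ] ∑[ u < n ] adjacency G u v ≡⟨ ∑-comm (λ v u → adjacency G u v) ⟩
    ∑[ u < n ] ∑[ v < n ] adjacency G u v ∎) u)
  where open ≡-Reasoning

-- Closed-walk counts

module _ (k : ℕ) (G : Digraph (M 2 k + 2)) (geodetic : IsGeodetic k G)
         (rows : ∀ u → ∑[ v < M 2 k + 2 ] adjacency G u v ≡ 2)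
         (four-sources : numInDeg G 1 ≡ 4) where

  private
    A = adjacency G
    C = geo A k
    order = M 2 k + 2
    s : Fin order → ℕ
    s v = bit (inDeg G v ≡ᵇ 1)

  sum-geo : ∀ m u → ∑[ v < order ] geo A m u v ≡ M 2 m
  sum-geo zero    u = trans (sum-cong-≗ λ v → sym (*-identityʳ (I u v))) (sum-I (λ _ → 1) u)
  sum-geo (suc m) u = begin
    ∑[ v < order ] (I u v + (A ⊗ geo A m) u v)
      ≡⟨ ∑-distrib-+ (I u) ((A ⊗ geo A m) u) ⟩
    ∑[ v < order ] I u v + ∑[ v < order ] (A ⊗ geo A m) u v
      ≡⟨ cong₂ _+_ (sum-geo zero u) (sum-⊗ A (geo A m) (sum-geo m) u) ⟩
    1 + ∑[ x < order ] A u x * M 2 m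
      ≡⟨ cong (λ t → 1 + t * M 2 m) (rows u) ⟩
    1 + 2 * M 2 m
      ≡⟨ M-suc m ⟨
    M 2 (suc m) ∎
    where open ≡-Reasoning

  sum-row-const : ∀ u c → ∑[ x < order ] (A u x * c) ≡ 2 * c
  sum-row-const u c = trans (sym (*-distribʳ-sum c (A u))) (cong (_* c) (rows u))

  A⊗C+s≤2 : ∀ u v → (A ⊗ C) u v + s v ≤ 2
  A⊗C+s≤2 u v with inDeg G v ≡ᵇ 1 in eq
  ... | false = begin
    (A ⊗ C) u v + 0             ≡⟨ +-identityʳ _ ⟩
    (A ⊗ C) u v                 ≤⟨ sum-mono (λ x → *-monoʳ-≤ (A u x) (geo≤1 G k geodetic x v)) ⟩
    ∑[ x < order ] (A u x * 1)  ≡⟨ sum-row-const u 1 ⟩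
    2                           ∎
    where open ≤-Reasoning
  -- Here `s v` is 1, so the entry itself must be at most 1. Moving `A` to the right bounds it by
  -- the in-degree of `v`.
  ... | true  = +-monoˡ-≤ 1 (begin
    (A ⊗ C) u v                 ≡⟨ geo-comm A k u v ⟩
    (C ⊗ A) u v                 ≤⟨ sum-mono (λ x → *-monoˡ-≤ (A x v) (geo≤1 G k geodetic u x)) ⟩
    ∑[ x < order ] (1 * A x v)  ≡⟨ sum-cong-≗ (λ x → *-identityˡ (A x v)) ⟩
    ∑[ x < order ] A x v        ≡⟨ inDeg≡sum G v ⟨
    inDeg G v                   ≡⟨ ≡ᵇ⇒≡ (inDeg G v) 1 (subst T (sym eq) _) ⟩
    1                           ∎)
    where open ≤-Reasoning

  sum-s : sum s ≡ 4
  sum-s = trans (sym (numInDeg≡sum G 1)) four-sources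

  -- Each row of the bound is tight in total, since 2M + 4 is twice the order M + 2.
  A⊗C+s≡2 : ∀ u v → (A ⊗ C) u v + s v ≡ 2
  A⊗C+s≡2 u = ≤∧sum≡⇒≡ (A⊗C+s≤2 u) (begin
    ∑[ v < order ] ((A ⊗ C) u v + s v)      ≡⟨ ∑-distrib-+ ((A ⊗ C) u) s ⟩
    ∑[ v < order ] (A ⊗ C) u v + sum s      ≡⟨ cong₂ _+_ (sum-⊗ A C (sum-geo k) u) sum-s ⟩
    ∑[ x < order ] A u x * M 2 k + 4        ≡⟨ cong (λ t → t * M 2 k + 4) (rows u) ⟩
    2 * M 2 k + 4                           ≡⟨ regroup (M 2 k) ⟩
    order * 2                               ≡⟨ sum-const order 2 ⟨
    ∑[ v < order ] 2                        ∎)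
    where
    open ≡-Reasoning
    regroup : ∀ x → 2 * x + 4 ≡ (x + 2) * 2
    regroup = solve-∀

  -- `geo A (suc k)` is both C + A^(k+1) and I + A C.
  ^^-suc-k : ∀ u v → (A ^^ suc k) u v + C u v + s v ≡ I u v + 2
  ^^-suc-k u v = begin
    (A ^^ suc k) u v + C u v + s v  ≡⟨ cong (_+ s v) (+-comm _ (C u v)) ⟩
    C u v + (A ^^ suc k) u v + s v  ≡⟨ cong (_+ s v) (geo-suc A k u v) ⟨
    I u v + (A ⊗ C) u v + s v       ≡⟨ +-assoc (I u v) _ (s v) ⟩
    I u v + ((A ⊗ C) u v + s v)     ≡⟨ cong (I u v +_) (A⊗C+s≡2 u v) ⟩
    I u v + 2                       ∎
    where open ≡-Reasoning

  -- By out-regularity, multiplying by `A` doubles a term that is constant along a column; hence the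
  -- powers of 2 in the recurrence that follows.
  A⊗-affine : ∀ (X : Matrix order) c u v → ∑[ x < order ] (A u x * (X x v + c)) ≡ (A ⊗ X) u v + 2 * c
  A⊗-affine X c u v = trans (⊗-distribˡ-⊕ A X (λ _ _ → c) u v) (cong ((A ⊗ X) u v +_) (sum-row-const u c))

  ^^-beyond-k : ∀ i u v → (A ^^ (suc k + suc i)) u v + 2 ^ i * s v ≡ (A ^^ suc i) u v + 2 ^ suc i
  -- Multiply `^^-suc-k` by `A` and subtract A C + 1 sᵀ = 2 J. The added 2 on the left is exchanged
  -- for `(A ⊗ C) u v + s v`, so that no subtraction occurs.
  ^^-beyond-k zero u v = +-cancelʳ-≡ 2 _ _ (begin
    (A ^^ (suc k + 1)) u v + (s v + 0) + 2
      ≡⟨ cong₂ (λ l t → (A ^^ l) u v + (s v + 0) + t) (+-comm (suc k) 1) (sym (A⊗C+s≡2 u v)) ⟩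
    (A ^^ suc (suc k)) u v + (s v + 0) + ((A ⊗ C) u v + s v)
      ≡⟨ regroup ((A ^^ suc (suc k)) u v) (s v) ((A ⊗ C) u v) ⟩
    (A ^^ suc (suc k)) u v + (A ⊗ C) u v + 2 * s v
      ≡⟨ cong (_+ 2 * s v) (⊗-distribˡ-⊕ A (A ^^ suc k) C u v) ⟨
    (A ⊗ (A ^^ suc k ⊕ C)) u v + 2 * s v
      ≡⟨ A⊗-affine (A ^^ suc k ⊕ C) (s v) u v ⟨
    ∑[ x < order ] (A u x * ((A ^^ suc k) x v + C x v + s v))
      ≡⟨ sum-cong-≗ (λ x → cong (A u x *_) (^^-suc-k x v)) ⟩
    ∑[ x < order ] (A u x * (I x v + 2))
      ≡⟨ A⊗-affine I 2 u v ⟩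
    (A ^^ 1) u v + 4
      ≡⟨ +-assoc ((A ^^ 1) u v) 2 2 ⟨
    (A ^^ 1) u v + 2 + 2 ∎)
    where
    open ≡-Reasoning
    regroup : ∀ x y z → x + (y + 0) + (z + y) ≡ x + z + 2 * y
    regroup = solve-∀
  ^^-beyond-k (suc i) u v = begin
    (A ^^ (suc k + suc (suc i))) u v + 2 ^ suc i * s v
      ≡⟨ cong₂ (λ l t → (A ^^ l) u v + t) (+-suc (suc k) (suc i)) (*-assoc 2 (2 ^ i) (s v)) ⟩
    (A ^^ suc (suc k + suc i)) u v + 2 * (2 ^ i * s v)
      ≡⟨ A⊗-affine (A ^^ (suc k + suc i)) (2 ^ i * s v) u v ⟨
    ∑[ x < order ] (A u x * ((A ^^ (suc k + suc i)) x v + 2 ^ i * s v))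
      ≡⟨ sum-cong-≗ (λ x → cong (A u x *_) (^^-beyond-k i x v)) ⟩
    ∑[ x < order ] (A u x * ((A ^^ suc i) x v + 2 ^ suc i))
      ≡⟨ A⊗-affine (A ^^ suc i) (2 ^ suc i) u v ⟩
    (A ^^ suc (suc i)) u v + 2 ^ suc (suc i) ∎
    where open ≡-Reasoning

  tr-suc-k : tr (A ^^ suc k) ≡ 2 * M 2 k
  tr-suc-k = +-cancelʳ-≡ 4 _ _ (begin
    tr (A ^^ suc k) + 4                        ≡⟨ cong (tr (A ^^ suc k) +_) sum-s ⟨
    tr (A ^^ suc k) + sum s                    ≡⟨ ∑-distrib-+ (λ u → (A ^^ suc k) u u) s ⟨
    ∑[ u < order ] ((A ^^ suc k) u u + s u)    ≡⟨ sum-cong-≗ diagonal ⟩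
    ∑[ u < order ] 2                           ≡⟨ sum-const order 2 ⟩
    order * 2                                  ≡⟨ regroup (M 2 k) ⟩
    2 * M 2 k + 4                              ∎)
    where
    open ≡-Reasoning
    regroup : ∀ x → (x + 2) * 2 ≡ 2 * x + 4
    regroup = solve-∀
    C-diag : ∀ u → C u u ≡ 1
    C-diag u = ≤-antisym (geo≤1 G k geodetic u u) (≤-trans (≤-reflexive (sym (I-diag u))) (I≤geo A k u u))
    swap : ∀ x y → suc (x + y) ≡ x + 1 + y
    swap = solve-∀
    -- The diagonal entries of `C` and `I` are both 1 and cancel in `^^-suc-k`.
    diagonal : ∀ u → (A ^^ suc k) u u + s u ≡ 2
    diagonal u = suc-injective (begin
      suc ((A ^^ suc k) u u + s u)      ≡⟨ swap ((A ^^ suc k) u u) (s u) ⟩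
      (A ^^ suc k) u u + 1 + s u        ≡⟨ cong (λ t → (A ^^ suc k) u u + t + s u) (C-diag u) ⟨
      (A ^^ suc k) u u + C u u + s u    ≡⟨ ^^-suc-k u u ⟩
      I u u + 2                         ≡⟨ cong (_+ 2) (I-diag u) ⟩
      3                                 ∎)

  -- The diagonal of `A ^^ suc i` vanishes since i + 1 ≤ k, leaving 2^(i+1) (M + 2) minus 2^i for
  -- each of the four vertices of in-degree 1.
  tr-beyond-k : ∀ i → suc i ≤ k → tr (A ^^ (suc k + suc i)) ≡ 2 ^ suc i * M 2 k
  tr-beyond-k i i<k = +-cancelʳ-≡ (2 ^ i * 4) _ _ (begin
    tr (A ^^ N) + 2 ^ i * 4
      ≡⟨ cong (λ t → tr (A ^^ N) + 2 ^ i * t) sum-s ⟨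
    tr (A ^^ N) + 2 ^ i * sum s
      ≡⟨ cong (tr (A ^^ N) +_) (*-distribˡ-sum (2 ^ i) s) ⟩
    tr (A ^^ N) + ∑[ u < order ] (2 ^ i * s u)
      ≡⟨ ∑-distrib-+ (λ u → (A ^^ N) u u) (λ u → 2 ^ i * s u) ⟨
    ∑[ u < order ] ((A ^^ N) u u + 2 ^ i * s u)
      ≡⟨ sum-cong-≗ (λ u → trans (^^-beyond-k i u u)
           (cong (_+ 2 ^ suc i) (closed-walks-of-length≤k G geodetic z<s i<k u))) ⟩
    ∑[ u < order ] (2 ^ suc i)
      ≡⟨ sum-const order (2 ^ suc i) ⟩
    order * 2 ^ suc i
      ≡⟨ regroup (M 2 k) (2 ^ i) ⟩
    2 ^ suc i * M 2 k + 2 ^ i * 4 ∎)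
    where
    open ≡-Reasoning
    N = suc k + suc i
    regroup : ∀ x y → (x + 2) * (2 * y) ≡ 2 * y * x + y * 4
    regroup = solve-∀

  suc-k∣ : suc k ∣ 2 * M 2 k
  suc-k∣ = subst (suc k ∣_) tr-suc-k
    (∣tr-^^ (suc k) A (geodetic⇒NoEarlyReturn G geodetic (s≤s (m≤m+n k k))))

  beyond-k∣ : ∀ i → suc i ≤ k → suc k + suc i ∣ 2 ^ suc i * M 2 k
  beyond-k∣ i i<k = subst (suc k + suc i ∣_) (tr-beyond-k i i<k)
    (∣tr-^^ (suc k + suc i) A (geodetic⇒NoEarlyReturn G geodetic (s≤s (+-monoʳ-≤ k i<k))))

-- Arithmetic of the divisibility conditions

coprime-2^ : ∀ {p x} → Coprime p 2 → ∀ i → p ∣ 2 ^ i * x → p ∣ x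
coprime-2^ {p} {x} c zero    p∣ = subst (p ∣_) (*-identityˡ x) p∣
coprime-2^ {p} {x} c (suc i) p∣ = coprime-2^ c i (coprime-divisor c (subst (p ∣_) (*-assoc 2 (2 ^ i) x) p∣))

-- The k consecutive lengths k + 2, ..., 2k + 1 contain a multiple of `p` because p ≤ k. It lies
-- `p ∸ suc k % p` beyond k + 1, a distance from 1 to p, and the power of 2 cancels because `p` is
-- coprime to 2.
∣-multiple-beyond : ∀ {k X p} .{{_ : NonZero p}} → Coprime p 2 → p ≤ k →
  (∀ i → suc i ≤ k → suc k + suc i ∣ 2 ^ suc i * X) → p ∣ X
∣-multiple-beyond {k} {X} {p} c p≤k divs with p ∸ suc k % p in eq
... | zero  = contradiction (m%n<n (suc k) p) (≤⇒≯ (m∸n≡0⇒m≤n eq))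
... | suc i = coprime-2^ c (suc i) (∣-trans p∣N (divs i (≤-trans (subst (_≤ p) eq (m∸n≤m p (suc k % p))) p≤k)))
  where
  open ≡-Reasoning
  q = suc k / p
  r = suc k % p
  p∣N : p ∣ suc k + suc i
  p∣N = divides (suc q) (begin
    suc k + suc i        ≡⟨ cong₂ _+_ (m≡m%n+[m/n]*n (suc k) p) (sym eq) ⟩
    r + q * p + (p ∸ r)  ≡⟨ +-comm (r + q * p) (p ∸ r) ⟩
    p ∸ r + (r + q * p)  ≡⟨ +-assoc (p ∸ r) r (q * p) ⟨
    p ∸ r + r + q * p    ≡⟨ cong (_+ q * p) (m∸n+n≡m (<⇒≤ (m%n<n (suc k) p))) ⟩
    suc q * p            ∎)

-- 16 is 1 modulo 15, a modulus that serves the primes 3 and 5 at once.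
2^4q≡1-mod-15 : ∀ q → ∃ λ t → 2 ^ (q * 4) ≡ 1 + 15 * t
2^4q≡1-mod-15 zero    = 0 , refl
2^4q≡1-mod-15 (suc q) with t , eq ← 2^4q≡1-mod-15 q = 1 + 16 * t , (begin
  2 * (2 * (2 * (2 * 2 ^ (q * 4))))  ≡⟨ cong (λ x → 2 * (2 * (2 * (2 * x)))) eq ⟩
  2 * (2 * (2 * (2 * (1 + 15 * t)))) ≡⟨ regroup t ⟩
  1 + 15 * (1 + 16 * t)              ∎)
  where
  open ≡-Reasoning
  regroup : ∀ t → 2 * (2 * (2 * (2 * (1 + 15 * t)))) ≡ 1 + 15 * (1 + 16 * t)
  regroup = solve-∀

-- Let r be the residue of k + 1 modulo 4. Then X is congruent to 2^r - 1 modulo 15, that is, to 0,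
-- 1, 3 or 7. For r = 1, 2, 3 the primes 3, 5, 3 respectively do not divide this value; r = 0 is
-- settled by parity.
no-such-k : ∀ {k X} → 2 ≤ k → suc X ≡ 2 ^ suc k → suc k ∣ 2 * X →
  ¬ (∀ i → suc i ≤ k → suc k + suc i ∣ 2 ^ suc i * X)
no-such-k {k} {X} 2≤k X≡ div divs =
  go (suc k % 4) (suc k / 4) (m%n<n (suc k) 4) (m≡m%n+[m/n]*n (suc k) 4)
  where
  X-mod-15 : ∀ r q → suc k ≡ r + q * 4 → ∃ λ t → X ≡ 15 * t + pred (2 ^ r)
  X-mod-15 r q k≡ with t , eq ← 2^4q≡1-mod-15 q = 2 ^ r * t , suc-injective (begin
    suc X                                  ≡⟨ X≡ ⟩
    2 ^ suc k                              ≡⟨ cong (2 ^_) k≡ ⟩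
    2 ^ (r + q * 4)                        ≡⟨ ^-distribˡ-+-* 2 r (q * 4) ⟩
    2 ^ r * 2 ^ (q * 4)                    ≡⟨ cong (2 ^ r *_) eq ⟩
    2 ^ r * (1 + 15 * t)                   ≡⟨ regroup (2 ^ r) t ⟩
    15 * (2 ^ r * t) + 2 ^ r               ≡⟨ cong (15 * (2 ^ r * t) +_) (suc-pred (2 ^ r) {{m^n≢0 2 r}}) ⟨
    15 * (2 ^ r * t) + suc (pred (2 ^ r))  ≡⟨ +-suc (15 * (2 ^ r * t)) (pred (2 ^ r)) ⟩
    suc (15 * (2 ^ r * t) + pred (2 ^ r))  ∎)
    where
    open ≡-Reasoning
    regroup : ∀ x t → x * (1 + 15 * t) ≡ 15 * (x * t) + x
    regroup = solve-∀

  residue : ∀ r q p .{{_ : NonZero p}} → suc k ≡ r + q * 4 → p ∣ 15 → Coprime p 2 → p ≤ k →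
            p ∣ pred (2 ^ r)
  residue r q p k≡ p∣15 c p≤k =
    ∣m+n∣m⇒∣n (subst (p ∣_) (proj₂ (X-mod-15 r q k≡)) (∣-multiple-beyond c p≤k divs))
      (∣m⇒∣m*n (proj₁ (X-mod-15 r q k≡)) p∣15)

  5≤k : ∀ r q → suc k ≡ suc r + suc q * 4 → 1 ≤ r → 5 ≤ k
  5≤k r q k≡ 1≤r = subst (5 ≤_) (sym (suc-injective k≡)) (+-mono-≤ 1≤r (m≤m+n 4 (q * 4)))

  4≤k : ∀ r q → suc k ≡ suc r + suc q * 4 → 4 ≤ k
  4≤k r q k≡ = subst (4 ≤_) (sym (suc-injective k≡)) (≤-trans (m≤m+n 4 (q * 4)) (m≤n+m _ r))

  3-coprime : Coprime 3 2
  3-coprime = toWitness {a? = coprime? 3 2} _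

  5-coprime : Coprime 5 2
  5-coprime = toWitness {a? = coprime? 5 2} _

  go : ∀ r q → r < 4 → suc k ≡ r + q * 4 → ⊥
  -- From 4 ∣ k + 1 ∣ 2X it follows that X is even, whereas X + 1 is a power of 2 with positive
  -- exponent.
  go 0 q _ k≡ = toWitnessFalse {a? = 2 ∣? 1} _
    (∣m+n∣m⇒∣n (subst (2 ∣_) (trans (sym X≡) (+-comm 1 X)) (m∣m*n (2 ^ k)))
      (*-cancelˡ-∣ 2 (∣-trans (divides q k≡) div)))
  go 1 zero _ k≡ = contradiction 2≤k (<⇒≱ (s≤s (≤-trans (≤-reflexive (suc-injective k≡)) z≤n)))
  go 1 (suc q) _ k≡ = toWitnessFalse {a? = 3 ∣? 1} _
    (residue 1 (suc q) 3 k≡ (divides 5 refl) 3-coprime (<⇒≤ (4≤k 0 q k≡)))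
  go 2 zero _ k≡ = contradiction 2≤k (<⇒≱ (s≤s (≤-reflexive (suc-injective k≡))))
  -- The prime 3 divides 2^2 - 1, so 5 takes its place; this requires k ≥ 5.
  go 2 (suc q) _ k≡ = toWitnessFalse {a? = 5 ∣? 3} _
    (residue 2 (suc q) 5 k≡ (divides 3 refl) 5-coprime (5≤k 1 q k≡ ≤-refl))
  -- This is k = 2, too small for `∣-multiple-beyond` with p = 3; the length k + 1 = 3 gives 3 ∣ 14
  -- instead.
  go 3 zero _ k≡ = toWitnessFalse {a? = 3 ∣? 14} _ (subst₂ _∣_ k≡ (cong (2 *_) X≡7) div)
    where
    X≡7 : X ≡ 7
    X≡7 = suc-injective (trans X≡ (cong (2 ^_) k≡))
  go 3 (suc q) _ k≡ = toWitnessFalse {a? = 3 ∣? 7} _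
    (residue 3 (suc q) 3 k≡ (divides 5 refl) 3-coprime (<⇒≤ (4≤k 2 q k≡)))
  go (suc (suc (suc (suc _)))) _ (s≤s (s≤s (s≤s (s≤s ())))) _

theorem3 : (k : ℕ) → 2 ≤ k → (G : Digraph (M 2 k + 2)) →
    ¬ (IsGeodetic k G × MinOutDegAtLeast 2 G × HasInDegSeq1111-2-334 G)
theorem3 k 2≤k G (geodetic , out≥2 , inDegs@(four , _)) =
  no-such-k 2≤k (M≡ k) (suc-k∣ k G geodetic rows four) (beyond-k∣ k G geodetic rows four)
  where
  rows = out-regular G out≥2 inDegs
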